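{- Let $G$ be a graph with $n$ vertices and $m$ edges that has a canonical dominating set. Then, for any two dominating sets $D_s,D_t$ of $G$ and any integer $k\ge\max\{|D_s|,|D_t|\}$, whether $D_s\leftrightarrow_k D_t$ holds can be decided in $O(n+m)$ time (without needing to know a canonical dominating set).
   Context: All graphs are finite, simple and undirected. A set $D\subseteq V(G)$ is a dominating set if every vertex of $G$ is in $D$ or adjacent to a vertex of $D$. Two dominating sets $D,D'$ of $G$ are adjacent if $|D\triangle D'|=1$. For dominating sets $D_p,D_q$ and an integer $k>0$, write $D_p\leftrightarrow_k D_q$ if there is a sequence $D_0=D_p,D_1,\dots,D_\ell=D_q$ ($\ell\ge 0$) of dominating sets of $G$ with $D_{i-1},D_i$ adjacent for all $i\ge1$ and $|D_i|\le k$ for all $i$. A minimum dominating set $D^*$ of $G$ is called canonical if $D\leftrightarrow_{|D|+1} D^*$ holds for every dominating set $D$ of $G$. -}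

module Defs where

open import Data.Bool.Base using (if_then_else_)
open import Data.Fin.Base using (Fin; toℕ)
open import Data.Fin.Properties using (_<?_)
open import Data.Fin.Subset using (Subset; _∈_; _∪_; _─_; ∣_∣)
open import Data.List.Base
  using (List; []; _∷_; length; map; filter; concat; take; tabulate; allFin; cartesianProduct)
open import Data.List.Membership.Propositional using () renaming (_∈_ to _∈ˡ_)
open import Data.List.Relation.Unary.Unique.Propositional using (Unique)
open import Data.Nat.Base using (ℕ; zero; suc; pred; _+_; _≤_; _<_; _≡ᵇ_)
open import Data.Product.Base using (_×_; _,_; ∃-syntax)
open import Data.Sum.Base using (_⊎_)
open import Data.Vec.Base using (toList)
open import Function.Bundles using (_⇔_)
open import Level using (0ℓ)
open import Relation.Binary.Construct.Closure.ReflexiveTransitive using (Star)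
open import Relation.Binary.Core using (Rel)
open import Relation.Binary.Definitions using (Symmetric; Irreflexive; Decidable)
open import Relation.Binary.PropositionalEquality using (_≡_)
open import Relation.Nullary using (¬_)
open import Relation.Nullary.Decidable using (_×-dec_)

------------------------------------------------------------------------
-- Graphs and dominating sets

record Graph (n : ℕ) : Set₁ where
  field
    Adj       : Rel (Fin n) 0ℓ
    adj?      : Decidable Adj
    symmetric : Symmetric Adj
    loopless  : Irreflexive _≡_ Adj

-- Each edge is listed once, with its smaller endpoint first.
edges : ∀ {n} → Graph n → List (Fin n × Fin n)
edges {n} G = filter (λ (u , v) → (u <? v) ×-dec adj? u v)
                     (cartesianProduct (allFin n) (allFin n))
  where open Graph G

#edges : ∀ {n} → Graph n → ℕ
#edges G = length (edges G)

infixl 5 _△_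

_△_ : ∀ {n} → Subset n → Subset n → Subset n
D △ E = (D ─ E) ∪ (E ─ D)

module _ {n : ℕ} (G : Graph n) where
  open Graph G

  Dominating : Subset n → Set
  Dominating D = ∀ v → v ∈ D ⊎ (∃[ u ] u ∈ D × Adj v u)

  Minimum : Subset n → Set
  Minimum D = Dominating D × (∀ E → Dominating E → ∣ D ∣ ≤ ∣ E ∣)

  Feasible : ℕ → Subset n → Set
  Feasible k D = Dominating D × ∣ D ∣ ≤ k

  Step : ℕ → Rel (Subset n) 0ℓ
  Step k D E = ∣ D △ E ∣ ≡ 1 × Feasible k E

  -- D ↔_k E.  Star (Step k) constrains every set of the sequence but the
  -- first, which is covered by Feasible k D.
  Reconfigurable : ℕ → Rel (Subset n) 0ℓ
  Reconfigurable k D E = Feasible k D × Star (Step k) D E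

  Canonical : Subset n → Set
  Canonical D* = Minimum D* ×
    (∀ D → Dominating D → Reconfigurable (suc ∣ D ∣) D D*)

  HasCanonical : Set
  HasCanonical = ∃[ D* ] Canonical D*

------------------------------------------------------------------------
-- Random access machines
--
-- Unit-cost RAM with finitely many registers and arrays (those a program
-- mentions), all holding natural numbers.  The only arithmetic is successor,
-- predecessor and comparison.  A unit-cost step therefore raises the largest
-- stored value by at most one (or to a constant of the program), so large
-- words cannot be used to pack several operations into one step.

Reg Arr : Set
Reg = ℕ
Arr = ℕ

infixr 5 _⨾_

data Program : Set where
  skip            : Program
  _⨾_             : Program → Program → Program
  const           : Reg → ℕ → Program
  copy succ decr  : Reg → Reg → Program
  load            : Reg → Arr → Reg → Program
  store           : Arr → Reg → Reg → Program
  if<             : Reg → Reg → Program → Program → Program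
  while<          : Reg → Reg → Program → Program

record State : Set where
  constructor ⟨_,_⟩
  field
    reg : Reg → ℕ
    arr : Arr → ℕ → ℕ

open State public

setReg : Reg → ℕ → State → State
setReg x w s = ⟨ (λ y → if x ≡ᵇ y then w else reg s y) , arr s ⟩

setArr : Arr → ℕ → ℕ → State → State
setArr a i w s =
  ⟨ reg s
  , (λ b j → if a ≡ᵇ b then (if i ≡ᵇ j then w else arr s b j) else arr s b j) ⟩

-- Run P s t s′: started in s, P halts in s′ after t steps.  Assignments and
-- tests cost one step each.
data Run : Program → State → ℕ → State → Set where
  skip  : ∀ {s} → Run skip s 0 s
  _⨾_   : ∀ {P Q s s′ s″ t t′} →
          Run P s t s′ → Run Q s′ t′ s″ → Run (P ⨾ Q) s (t + t′) s″
  const : ∀ {x c s} → Run (const x c) s 1 (setReg x c s)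
  copy  : ∀ {x y s} → Run (copy x y) s 1 (setReg x (reg s y) s)
  succ  : ∀ {x y s} → Run (succ x y) s 1 (setReg x (suc (reg s y)) s)
  decr  : ∀ {x y s} → Run (decr x y) s 1 (setReg x (pred (reg s y)) s)
  load  : ∀ {x a y s} → Run (load x a y) s 1 (setReg x (arr s a (reg s y)) s)
  store : ∀ {a x y s} → Run (store a x y) s 1 (setArr a (reg s x) (reg s y) s)
  if-then  : ∀ {x y P Q s s′ t} → reg s x < reg s y →
             Run P s t s′ → Run (if< x y P Q) s (suc t) s′
  if-else  : ∀ {x y P Q s s′ t} → ¬ (reg s x < reg s y) →
             Run Q s t s′ → Run (if< x y P Q) s (suc t) s′
  while-do : ∀ {x y P s s′ s″ t t′} → reg s x < reg s y →
             Run P s t s′ → Run (while< x y P) s′ t′ s″ →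
             Run (while< x y P) s (suc (t + t′)) s″
  while-end : ∀ {x y P s} → ¬ (reg s x < reg s y) →
              Run (while< x y P) s 1 s

-- The answer is left in register 0: 1 for yes, 0 for no.
DecidesWithin : Program → State → ℕ → Set → Set
DecidesWithin P s bound A =
  ∃[ t ] ∃[ s′ ] Run P s t s′ × t ≤ bound ×
    ((reg s′ 0 ≡ 1 × A) ⊎ (reg s′ 0 ≡ 0 × ¬ A))

------------------------------------------------------------------------
-- Input encoding

-- The order of the neighbours within each list is arbitrary.
record AdjacencyLists {n : ℕ} (G : Graph n) : Set where
  open Graph G
  field
    neighbours : Fin n → List (Fin n)
    unique     : ∀ v → Unique (neighbours v)
    complete   : ∀ v u → u ∈ˡ neighbours v ⇔ Adj v u

infixl 9 _‼_

_‼_ : List ℕ → ℕ → ℕ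
[]       ‼ i     = 0
(w ∷ ws) ‼ zero  = w
(w ∷ ws) ‼ suc i = ws ‼ i

indicator : ∀ {n} → Subset n → List ℕ
indicator D = map (λ b → if b then 1 else 0) (toList D)

-- Register 0 holds n and register 1 holds k.  The adjacency lists are
-- concatenated in array 1; that of vertex v occupies the positions from
-- (array 0)[v] up to, but excluding, (array 0)[v + 1].  Arrays 2 and 3 hold the
-- characteristic vectors of the two sets.  Array 0 is constant beyond position n;
-- all other unused cells are 0.
input : ∀ {n} {G : Graph n} → AdjacencyLists G → Subset n → Subset n → ℕ → State
input {n} L Ds Dt k = ⟨ registers , arrays ⟩
  where
  open AdjacencyLists L

  lists : List (List (Fin n))
  lists = tabulate neighbours

  registers : Reg → ℕ
  registers 0 = n
  registers 1 = k
  registers _ = 0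

  arrays : Arr → ℕ → ℕ
  arrays 0 v = length (concat (take v lists))
  arrays 1 i = map toℕ (concat lists) ‼ i
  arrays 2 v = indicator Ds ‼ v
  arrays 3 v = indicator Dt ‼ v
  arrays _ _ = 0

{-# OPTIONS --safe #-}
module Submission where

-- Let |D| ≤ k.  If |D| < k, or some v can be removed from D, then D reaches the
-- canonical set within size k; otherwise no move from D is possible at all.
-- Hence Ds ↔ Dt holds exactly when Ds = Dt or both sets have such a first move.
-- A member v of D can be removed unless some closed neighbourhood N[u] meets D in
-- v alone.  One pass over the adjacency lists counts |N[u] ∩ D| for every u and,
-- when it is 1, marks the unique element.

open import Defs
open import Data.Bool.Base using (true; false; T)
open import Data.Empty using (⊥-elim)
open import Data.Fin.Base as Fin using (Fin; zero; suc; toℕ; fromℕ<)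
open import Data.Fin.Properties using (toℕ<n; toℕ-injective; toℕ-fromℕ<; _<?_; _≟_)
import Data.Fin.Properties as Fin
open import Data.Fin.Subset using (Subset; _∈_; _∉_; _⊆_; _-_; ∣_∣)
open import Data.Fin.Subset.Properties
  using (_∈?_; ∪-comm; x∈p⇒∣p-x∣<∣p∣; x∈p∧x≢y⇒x∈p-y; p─⊥≡p; drop-there)
open import Data.List.Base
  using (List; []; _∷_; _++_; length; map; filter; concat; take; tabulate)
open import Data.List.Membership.Propositional using () renaming (_∈_ to _∈ˡ_)
open import Data.List.Membership.Propositional.Properties
  using (∈-filter⁺; ∈-filter⁻; ∈-allFin; ∈-cartesianProduct⁺; ∈-++⁺ˡ; ∈-++⁺ʳ; ∈-++⁻;
         ∈-map⁺; ∈-map⁻; ∈-concat⁻′; ∈-tabulate⁻; ∈-∃++)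
open import Data.List.Properties
  using (length-++; length-map; filter-accept; filter-reject; filter-++; ++-assoc;
         ++-identityʳ; map-++)
import Data.List.Relation.Unary.All as All
import Data.List.Relation.Unary.All.Properties as All
open import Data.List.Relation.Unary.AllPairs using ([]; _∷_)
import Data.List.Relation.Unary.AllPairs.Properties as AllPairs
open import Data.List.Relation.Unary.Any using (here; there)
open import Data.List.Relation.Unary.Unique.Propositional using (Unique)
import Data.List.Relation.Unary.Unique.Propositional.Properties as Unique
open import Data.Nat.Base using (ℕ; zero; suc; _+_; _*_; _∸_; _⊔_; _≤_; _<_; z≤n; s≤s; _≡ᵇ_)
open import Data.Nat.Properties hiding (_<?_; _≟_)
import Data.Nat.Properties as ℕ
open import Data.Nat.Tactic.RingSolver using (solve-∀)
open import Data.Product.Base using (Σ-syntax; ∃-syntax; _×_; _,_; proj₁; swap)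
open import Data.Sum.Base using (_⊎_; inj₁; inj₂)
open import Data.Unit.Base using (⊤; tt)
open import Data.Vec.Base using ([]; _∷_; here; there)
open import Function.Base using (_∘_)
open import Function.Bundles using (Equivalence)
open import Relation.Binary.Construct.Closure.ReflexiveTransitive using (Star; ε; _◅_; _◅◅_)
open import Relation.Binary.Definitions using (tri<; tri≈; tri>)
open import Relation.Binary.PropositionalEquality
open import Relation.Nullary using (¬_; yes; no; contradiction)
open import Relation.Nullary.Decidable using (_×-dec_; decidable-stable)

-- Symmetric difference and single moves

-- A removal buys the one unit of slack that canonicity asks for: if |D| = k, then `D - v` has size
-- k - 1, and its path to the canonical set stays within k. Two movable sets therefore meet at the
-- canonical set, whichever set that is, and the program never computes it. The obstacle is the time
-- bound: rechecking domination of `D - v` for every v is not linear. Counting at the dominated end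
-- u avoids this, since each u protects at most one v from removal. The edge count enters because
-- the adjacency lists have total length at most twice the number of edges. Decidability of
-- movability is not proved beforehand. Each run of the program ends with a register and a proof of
-- the property or of its negation, which is what settles the case distinction.

△-comm : ∀ {n} (D E : Subset n) → D △ E ≡ E △ D
△-comm D E = ∪-comm _ _

∣△∣≡0⇒≡ : ∀ {n} (D E : Subset n) → ∣ D △ E ∣ ≡ 0 → D ≡ E
∣△∣≡0⇒≡ [] [] _ = refl
∣△∣≡0⇒≡ (true  ∷ D) (true  ∷ E) eq = cong (true ∷_) (∣△∣≡0⇒≡ D E eq)
∣△∣≡0⇒≡ (false ∷ D) (false ∷ E) eq = cong (false ∷_) (∣△∣≡0⇒≡ D E eq)

∣△∣-refl : ∀ {n} (D : Subset n) → ∣ D △ D ∣ ≡ 0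
∣△∣-refl []          = refl
∣△∣-refl (true  ∷ D) = ∣△∣-refl D
∣△∣-refl (false ∷ D) = ∣△∣-refl D

∣△-∣≡1 : ∀ {n} {D : Subset n} {v} → v ∈ D → ∣ D △ (D - v) ∣ ≡ 1
∣△-∣≡1 {D = true ∷ D} here = cong suc (trans (cong (λ E → ∣ D △ E ∣) (p─⊥≡p D)) (∣△∣-refl D))
∣△-∣≡1 {D = true  ∷ D} (there v∈D) = ∣△-∣≡1 v∈D
∣△-∣≡1 {D = false ∷ D} (there v∈D) = ∣△-∣≡1 v∈D

-- The two cases keep only what the analysis of frozen sets needs: an addition is ruled out by size,
-- a removal by the vertex that it drops.
add-or-remove : ∀ {n} (D E : Subset n) → ∣ D △ E ∣ ≡ 1 →
  ∣ E ∣ ≡ suc ∣ D ∣ ⊎ (∃[ v ] v ∈ D × v ∉ E × E ⊆ D)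
add-or-remove [] [] ()
add-or-remove (true ∷ D) (true ∷ E) eq with add-or-remove D E eq
... | inj₁ p = inj₁ (cong suc p)
... | inj₂ (v , v∈D , v∉E , E⊆D) =
  inj₂ (suc v , there v∈D , v∉E ∘ drop-there , λ { here → here ; (there x) → there (E⊆D x) })
add-or-remove (false ∷ D) (false ∷ E) eq with add-or-remove D E eq
... | inj₁ p = inj₁ p
... | inj₂ (v , v∈D , v∉E , E⊆D) =
  inj₂ (suc v , there v∈D , v∉E ∘ drop-there , λ { (there x) → there (E⊆D x) })
add-or-remove (true ∷ D) (false ∷ E) eq with ∣△∣≡0⇒≡ D E (suc-injective eq)
... | refl = inj₂ (zero , here , (λ ()) , λ { (there x) → there x })
add-or-remove (false ∷ D) (true ∷ E) eq with ∣△∣≡0⇒≡ D E (suc-injective eq)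
... | refl = inj₁ refl

-- Reconfiguration

module _ {n} (G : Graph n) where

  feasible-mono : ∀ {k l D} → k ≤ l → Feasible G k D → Feasible G l D
  feasible-mono k≤l (dom , D≤k) = dom , ≤-trans D≤k k≤l

  reconfigurable-mono : ∀ {k l D E} → k ≤ l → Reconfigurable G k D E → Reconfigurable G l D E
  reconfigurable-mono {k} {l} k≤l (feas , moves) = feasible-mono k≤l feas , go moves
    where
    go : ∀ {D E} → Star (Step G k) D E → Star (Step G l) D E
    go ε = ε
    go ((one , feas) ◅ moves) = (one , feasible-mono k≤l feas) ◅ go moves

  reconfigurable-trans : ∀ {k D E F} →
    Reconfigurable G k D E → Reconfigurable G k E F → Reconfigurable G k D F
  reconfigurable-trans (feas , p) (_ , q) = feas , p ◅◅ q

  -- A reversed step ends in the set where the original step began, and `Star` does not record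
  -- feasibility there. Hence `go` carries the feasibility of the current first set.
  reconfigurable-sym : ∀ {k D E} → Reconfigurable G k D E → Reconfigurable G k E D
  reconfigurable-sym (feas , moves) = go feas moves
    where
    go : ∀ {k D E} → Feasible G k D → Star (Step G k) D E → Reconfigurable G k E D
    go feas ε = feas , ε
    go {D = D} feas (_◅_ {j = E} (one , feas′) moves) =
      let feas″ , moves′ = go feas′ moves
      in feas″ , moves′ ◅◅ ((trans (cong ∣_∣ (△-comm E D)) one , feas) ◅ ε)

-- Applied to the dominators of a vertex, this supplies one that survives the removal of `v`. If the
-- first entry is `v`, uniqueness makes the second differ from it.
other-member : ∀ {n} {v : Fin n} {xs} → Unique xs → ∃[ x ] x ∈ˡ xs → xs ≢ v ∷ [] →
  ∃[ x ] x ∈ˡ xs × x ≢ v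
other-member {xs = x ∷ []} _ _ xs≢ = x , here refl , λ { refl → xs≢ refl }
other-member {v = v} {xs = x ∷ y ∷ _} ((x≢y All.∷ _) ∷ _) _ _ with x ≟ v
... | no x≢v = x , here refl , x≢v
... | yes refl = y , there (here refl) , x≢y ∘ sym

-- Private neighbours, removable vertices and frozen sets

module _ {n} {G : Graph n} (L : AdjacencyLists G) where
  open AdjacencyLists L
  open Graph G

  dominators : Subset n → Fin n → List (Fin n)
  dominators D u = filter (_∈? D) (u ∷ neighbours u)

  -- The vertex `u` is a private neighbour of `v` with respect to `D`, possibly `v` itself. The list
  -- form exposes the length that the program counts.
  Critical : Subset n → Fin n → Set
  Critical D v = ∃[ u ] dominators D u ≡ v ∷ []

  Removable : Subset n → Fin n → Set
  Removable D v = v ∈ D × ¬ Critical D v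

  ∈dominators⁻ : ∀ {D u x} → x ∈ˡ dominators D u → x ∈ D × (x ≡ u ⊎ Adj u x)
  ∈dominators⁻ {D} {u} x∈ with ∈-filter⁻ (_∈? D) {xs = u ∷ neighbours u} x∈
  ... | here eq , x∈D = x∈D , inj₁ eq
  ... | there p , x∈D = x∈D , inj₂ (Equivalence.to (complete _ _) p)

  dominators-nonempty : ∀ {D} → Dominating G D → ∀ u → ∃[ x ] x ∈ˡ dominators D u
  dominators-nonempty {D} dom u with dom u
  ... | inj₁ u∈D = u , ∈-filter⁺ (_∈? D) {xs = u ∷ neighbours u} (here refl) u∈D
  ... | inj₂ (x , x∈D , u~x) =
    x , ∈-filter⁺ (_∈? D) {xs = u ∷ neighbours u} (there (Equivalence.from (complete u x) u~x)) x∈D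

  dominators-unique : ∀ D u → Unique (dominators D u)
  dominators-unique D u = Unique.filter⁺ (_∈? D) {xs = u ∷ neighbours u}
    (All.tabulate (λ x∈ u≡x → loopless u≡x (Equivalence.to (complete _ _) x∈)) ∷ unique u)

  removable⇒dominating : ∀ {D} → Dominating G D → ∀ {v} → Removable D v → Dominating G (D - v)
  removable⇒dominating {D} dom (_ , ¬crit) u
    with other-member (dominators-unique D u) (dominators-nonempty dom u) (¬crit ∘ (u ,_))
  ... | x , x∈ , x≢v with ∈dominators⁻ {D} {u} x∈
  ... | x∈D , inj₁ refl = inj₁ (x∈p∧x≢y⇒x∈p-y x∈D x≢v)
  ... | x∈D , inj₂ u~x  = inj₂ (x , x∈p∧x≢y⇒x∈p-y x∈D x≢v , u~x)

  -- The private neighbour `u` has a dominator in `E`. It also lies in `D`, so it can only be `v`.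
  critical⇒∈ : ∀ {D E v} → E ⊆ D → Dominating G E → Critical D v → v ∈ E
  critical⇒∈ {D} {E} E⊆D dom (u , eq) with dominators-nonempty dom u
  ... | x , x∈ with ∈-filter⁻ (_∈? E) {xs = u ∷ neighbours u} x∈
  ... | x∈N , x∈E with subst (x ∈ˡ_) eq (∈-filter⁺ (_∈? D) x∈N (E⊆D x∈E))
  ... | here refl = x∈E

  Movable : ℕ → Subset n → Set
  Movable k D = ∣ D ∣ < k ⊎ ∃[ v ] Removable D v

  -- It suffices to refute a first step: an addition within the bound gives |D| < k, and a removal
  -- that keeps domination removes a vertex that is not critical.
  frozen : ∀ {k D E} → ∣ D ∣ ≤ k → ¬ Movable k D → Star (Step G k) D E → D ≡ E
  frozen _ _ ε = refl
  frozen {k} {D} D≤k ¬mov (_◅_ {j = E} (one , dom , E≤k) _) with add-or-remove D E one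
  ... | inj₁ eq = contradiction (inj₁ (subst (_≤ k) eq E≤k)) ¬mov
  ... | inj₂ (v , v∈D , v∉E , E⊆D) =
    contradiction (inj₂ (v , v∈D , v∉E ∘ critical⇒∈ E⊆D dom)) ¬mov

  movable⇒reaches : ∀ {k D D*} → Canonical G D* → Feasible G k D →
    Movable k D → Reconfigurable G k D D*
  movable⇒reaches (_ , canon) (dom , _) (inj₁ D<k) = reconfigurable-mono G D<k (canon _ dom)
  movable⇒reaches {k} {D} (_ , canon) (dom , D≤k) (inj₂ (v , v∈D , ¬crit)) =
    reconfigurable-trans G
      ((dom , D≤k) , (∣△-∣≡1 v∈D , dom′ , ≤-trans (n≤1+n _) D-v<k) ◅ ε)
      (reconfigurable-mono G D-v<k (canon _ dom′))
    where
    dom′ : Dominating G (D - v)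
    dom′ = removable⇒dominating dom (v∈D , ¬crit)

    D-v<k : ∣ D - v ∣ < k
    D-v<k = ≤-trans (x∈p⇒∣p-x∣<∣p∣ v∈D) D≤k

  movable⇒reconfigurable : HasCanonical G → ∀ {k D E} →
    Feasible G k D → Feasible G k E → Movable k D → Movable k E → Reconfigurable G k D E
  movable⇒reconfigurable (_ , canon) D-feas E-feas D-mov E-mov = reconfigurable-trans G
    (movable⇒reaches canon D-feas D-mov)
    (reconfigurable-sym G (movable⇒reaches canon E-feas E-mov))

  -- The negated conjunction does not tell which set is frozen, so equality comes doubly negated.
  -- That is enough for the refutation in `verdict`.
  frozen⇒¬¬≡ : ∀ {k D E} → ¬ (Movable k D × Movable k E) → Reconfigurable G k D E → ¬ ¬ (D ≡ E)
  frozen⇒¬¬≡ ¬both r@((_ , D≤k) , moves) D≢E with reconfigurable-sym G r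
  ... | (_ , E≤k) , moves˘ =
    D≢E (frozen D≤k (λ D-mov →
      D≢E (sym (frozen E≤k (λ E-mov → ¬both (D-mov , E-mov)) moves˘))) moves)

-- Counting edges

unique-⊆⇒length-≤ : ∀ {A : Set} {xs ys : List A} → Unique xs →
  (∀ {x} → x ∈ˡ xs → x ∈ˡ ys) → length xs ≤ length ys
unique-⊆⇒length-≤ {xs = []} _ _ = z≤n
unique-⊆⇒length-≤ {xs = x ∷ xs} {ys} (x∉xs ∷ uniq) xs⊆ys with ∈-∃++ (xs⊆ys (here refl))
... | as , bs , refl = begin
  suc (length xs)              ≤⟨ s≤s (unique-⊆⇒length-≤ uniq xs⊆as++bs) ⟩
  suc (length (as ++ bs))      ≡⟨ cong suc (length-++ as) ⟩
  suc (length as + length bs)  ≡⟨ +-suc _ _ ⟨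
  length as + suc (length bs)  ≡⟨ length-++ as ⟨
  length (as ++ x ∷ bs)        ∎
  where
  open ≤-Reasoning
  xs⊆as++bs : ∀ {y} → y ∈ˡ xs → y ∈ˡ as ++ bs
  xs⊆as++bs y∈xs with ∈-++⁻ as (xs⊆ys (there y∈xs))
  ... | inj₁ y∈as = ∈-++⁺ˡ y∈as
  ... | inj₂ (here refl) = contradiction refl (All.lookup x∉xs y∈xs)
  ... | inj₂ (there y∈bs) = ∈-++⁺ʳ as y∈bs

length-concat-tabulate-map : ∀ {n} {A B : Set} (f : Fin n → List A) (g : Fin n → A → B) →
  length (concat (tabulate (λ v → map (g v) (f v)))) ≡ length (concat (tabulate f))
length-concat-tabulate-map {zero} f g = refl
length-concat-tabulate-map {suc n} f g = begin
  length (map (g zero) (f zero) ++ _)  ≡⟨ length-++ (map (g zero) (f zero)) ⟩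
  length (map (g zero) (f zero)) + _
    ≡⟨ cong₂ _+_ (length-map (g zero) (f zero)) (length-concat-tabulate-map (f ∘ suc) (g ∘ suc)) ⟩
  length (f zero) + _                  ≡⟨ length-++ (f zero) ⟨
  length (f zero ++ _)                 ∎
  where open ≡-Reasoning

module _ {n} {G : Graph n} (L : AdjacencyLists G) where
  open AdjacencyLists L
  open Graph G

  -- Tagging each entry with the owner of its list makes the concatenation duplicate-free without
  -- changing its length, so it can be compared with the edges taken in both directions.
  arcs : List (Fin n × Fin n)
  arcs = concat (tabulate (λ v → map (v ,_) (neighbours v)))

  arcs-unique : Unique arcs
  arcs-unique = Unique.concat⁺
    (All.tabulate⁺ (λ v → Unique.map⁺ (λ { refl → refl }) (unique v)))
    (AllPairs.tabulate⁺ disjoint)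
    where
    disjoint : ∀ {v w} → v ≢ w → ∀ {e} →
      ¬ (e ∈ˡ map (v ,_) (neighbours v) × e ∈ˡ map (w ,_) (neighbours w))
    disjoint v≢w (p , q) with ∈-map⁻ _ p | ∈-map⁻ _ q
    ... | _ , _ , refl | _ , _ , refl = v≢w refl

  edge-listed : ∀ {u v} → u Fin.< v → Adj u v → (u , v) ∈ˡ edges G
  edge-listed {u} {v} u<v u~v = ∈-filter⁺ (λ (u , v) → (u <? v) ×-dec adj? u v)
    (∈-cartesianProduct⁺ (∈-allFin u) (∈-allFin v)) (u<v , u~v)

  arc⇒edge : ∀ {e} → e ∈ˡ arcs → e ∈ˡ edges G ++ map swap (edges G)
  arc⇒edge e∈ with ∈-concat⁻′ (tabulate (λ v → map (v ,_) (neighbours v))) e∈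
  ... | _ , e∈es , es∈ with ∈-tabulate⁻ es∈
  ... | u , refl with ∈-map⁻ _ e∈es
  ... | v , v∈ , refl with Equivalence.to (complete u v) v∈ | Fin.<-cmp u v
  ... | u~v | tri< u<v _ _ = ∈-++⁺ˡ (edge-listed u<v u~v)
  ... | u~v | tri≈ _ u≡v _ = contradiction u~v (loopless u≡v)
  ... | u~v | tri> _ _ v<u = ∈-++⁺ʳ (edges G) (∈-map⁺ swap (edge-listed v<u (symmetric u~v)))

  total-degree-≤ : length (concat (tabulate neighbours)) ≤ #edges G + #edges G
  total-degree-≤ = begin
    length (concat (tabulate neighbours))     ≡⟨ length-concat-tabulate-map neighbours _,_ ⟨
    length arcs                               ≤⟨ unique-⊆⇒length-≤ arcs-unique arc⇒edge ⟩
    length (edges G ++ map swap (edges G))    ≡⟨ length-++ (edges G) ⟩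
    #edges G + length (map swap (edges G))    ≡⟨ cong (#edges G +_) (length-map swap (edges G)) ⟩
    #edges G + #edges G                       ∎
    where open ≤-Reasoning

-- Running programs

-- A total-correctness triple with a time bound. `DecidesWithin` is the instance whose postcondition
-- is a `Bit` in register 0.
Within : Program → State → ℕ → (State → Set) → Set
Within P s b Q = ∃[ t ] ∃[ s′ ] Run P s t s′ × t ≤ b × Q s′

infixr 4 _▸_ _>>=_

within : ∀ {P s t s′ b Q} → Run P s t s′ → t ≤ b → Q s′ → Within P s b Q
within r t≤b q = _ , _ , r , t≤b , q

weaken : ∀ {P s b b′ Q} → b ≤ b′ → Within P s b Q → Within P s b′ Q
weaken b≤b′ (_ , _ , r , t≤b , q) = within r (≤-trans t≤b b≤b′) q

map-within : ∀ {P s b Q R} → (∀ {s′} → Q s′ → R s′) → Within P s b Q → Within P s b R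
map-within f (_ , _ , r , t≤b , q) = within r t≤b (f q)

-- Here the intermediate state stays explicit, so later register reads reduce by computation;
-- `_>>=_` keeps only a postcondition of it.
_▸_ : ∀ {P P′ s t s′ b Q} → Run P s t s′ → Within P′ s′ b Q → Within (P ⨾ P′) s (t + b) Q
_▸_ {t = t} r (_ , _ , r′ , t≤b , q) = within (r ⨾ r′) (+-monoʳ-≤ t t≤b) q

_>>=_ : ∀ {P P′ s b b′ Q R} → Within P s b Q → (∀ {s′} → Q s′ → Within P′ s′ b′ R) →
  Within (P ⨾ P′) s (b + b′) R
(_ , _ , r , t≤b , q) >>= f with f q
... | _ , _ , r′ , t′≤b′ , q′ = within (r ⨾ r′) (+-mono-≤ t≤b t′≤b′) q′

within-if : ∀ {x y P Q s b R} → (reg s x < reg s y → Within P s b R) →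
  (¬ (reg s x < reg s y) → Within Q s b R) → Within (if< x y P Q) s (suc b) R
within-if {x} {y} {s = s} f g with reg s x ℕ.<? reg s y
... | yes lt = let _ , _ , r , t≤b , q = f lt in within (if-then lt r) (s≤s t≤b) q
... | no ¬lt = let _ , _ , r , t≤b , q = g ¬lt in within (if-else ¬lt r) (s≤s t≤b) q

within-while : ∀ {x y P s b b′ Q R} → reg s x < reg s y → Within P s b Q →
  (∀ {s′} → Q s′ → Within (while< x y P) s′ b′ R) →
  Within (while< x y P) s (suc (b + b′)) R
within-while lt (_ , _ , r , t≤b , q) f with f q
... | _ , _ , r′ , t′≤b′ , q′ = within (while-do lt r r′) (s≤s (+-mono-≤ t≤b t′≤b′)) q′

-- Φ i bounds the time spent on the first i iterations.
for-loop : ∀ {N x y P} (I : ℕ → State → Set) (Φ cost : ℕ → ℕ) →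
  (∀ {i s} → I i s → reg s x ≡ i × reg s y ≡ N) →
  (∀ (w : Fin N) {s} → I (toℕ w) s → Within P s (cost (toℕ w)) (I (suc (toℕ w)))) →
  (∀ (w : Fin N) → suc (cost (toℕ w)) + Φ (toℕ w) ≤ Φ (suc (toℕ w))) →
  Φ 0 ≡ 0 → ∀ {s} → I 0 s → Within (while< x y P) s (suc (Φ N)) (I N)
for-loop {N} {x} {y} {P} I Φ cost counter body amortised Φ0 inv
  with go N refl inv
  where
  -- `d` is the number of iterations left. The extra unit in `suc (Φ N)` pays for the test that ends
  -- the loop.
  go : ∀ d {i s} → i + d ≡ N → I i s →
    ∃[ t ] ∃[ s′ ] Run (while< x y P) s t s′ × t + Φ i ≤ suc (Φ N) × I N s′
  go zero {i} eq inv with counter inv | trans (sym (+-identityʳ i)) eq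
  ... | x≡ , y≡ | refl =
    _ , _ , while-end (λ lt → <-irrefl (trans x≡ (sym y≡)) lt) , ≤-refl , inv
  go (suc d) {i} {s} eq inv with counter inv | subst (i <_) eq (m<m+n i (s≤s z≤n))
  ... | x≡ , y≡ | i<N
    with fromℕ< i<N | toℕ-fromℕ< i<N
  ... | w | refl with body w inv
  ... | t , _ , r , t≤cost , inv′ with go d (trans (sym (+-suc _ d)) eq) inv′
  ... | t′ , _ , r′ , t′≤ , post =
    _ , _ , while-do (subst₂ _<_ (sym x≡) (sym y≡) i<N) r r′ , bound , post
    where
    open ≤-Reasoning
    bound : suc (t + t′) + Φ (toℕ w) ≤ suc (Φ N)
    bound = begin
      suc (t + t′) + Φ (toℕ w)               ≤⟨ s≤s (+-monoˡ-≤ _ (+-monoˡ-≤ t′ t≤cost)) ⟩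
      suc (cost (toℕ w) + t′ + Φ (toℕ w))    ≡⟨ rearrange (cost (toℕ w)) t′ (Φ (toℕ w)) ⟩
      t′ + (suc (cost (toℕ w)) + Φ (toℕ w))  ≤⟨ +-monoʳ-≤ t′ (amortised w) ⟩
      t′ + Φ (suc (toℕ w))                   ≤⟨ t′≤ ⟩
      suc (Φ N)                              ∎
      where
      rearrange : ∀ c t φ → suc (c + t + φ) ≡ t + (suc c + φ)
      rearrange = solve-∀
... | t , _ , r , t+Φ0≤ , post =
  within r (subst (_≤ suc (Φ N)) (trans (cong (t +_) Φ0) (+-identityʳ t)) t+Φ0≤) post

-- Truth values in registers and arrays

Bit : Set → ℕ → Set
Bit A z = (z ≡ 1 × A) ⊎ (z ≡ 0 × ¬ A)

positive⇒ : ∀ {A z} → Bit A z → 0 < z → A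
positive⇒ (inj₁ (_ , p)) _ = p
positive⇒ (inj₂ (refl , _)) ()

nonpositive⇒ : ∀ {A z} → Bit A z → ¬ (0 < z) → ¬ A
nonpositive⇒ (inj₁ (refl , _)) ¬pos = contradiction (s≤s z≤n) ¬pos
nonpositive⇒ (inj₂ (_ , ¬p)) _ = ¬p

-- For bits, z < y forces y = 1 and z = 0, so one comparison tests a conjunction with a negation,
-- such as "member and not marked".
<⇒ : ∀ {A B y z} → Bit A y → Bit B z → z < y → A × ¬ B
<⇒ (inj₁ (refl , p)) (inj₂ (refl , ¬q)) _ = p , ¬q
<⇒ (inj₁ (refl , _)) (inj₁ (refl , _)) (s≤s ())
<⇒ (inj₂ (refl , _)) _ ()

≮⇒ : ∀ {A B y z} → Bit A y → Bit B z → ¬ (z < y) → ¬ (A × ¬ B)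
≮⇒ (inj₁ (refl , _)) (inj₁ (refl , q)) _ (_ , ¬q) = ¬q q
≮⇒ (inj₁ (refl , _)) (inj₂ (refl , _)) ≮ _ = ≮ (s≤s z≤n)
≮⇒ (inj₂ (refl , ¬p)) _ _ (p , _) = ¬p p

positive⇒≡1 : ∀ {A z} → Bit A z → 0 < z → z ≡ 1
positive⇒≡1 (inj₁ (z≡1 , _)) _ = z≡1
positive⇒≡1 (inj₂ (refl , _)) ()

SomeBelow : ∀ {n} → (Fin n → Set) → ℕ → Set
SomeBelow P i = ∃[ u ] toℕ u < i × P u

bit-extend : ∀ {n} {P : Fin n → Set} (w : Fin n) {z} → ¬ P w →
  Bit (SomeBelow P (toℕ w)) z → Bit (SomeBelow P (suc (toℕ w))) z
bit-extend w ¬Pw (inj₁ (z≡1 , u , u<w , Pu)) = inj₁ (z≡1 , u , m≤n⇒m≤1+n u<w , Pu)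
bit-extend {P = P} w ¬Pw (inj₂ (z≡0 , none)) = inj₂ (z≡0 , none′)
  where
  none′ : ¬ SomeBelow P (suc (toℕ w))
  none′ (u , s≤s u≤w , Pu) with u ≟ w
  ... | yes refl = ¬Pw Pu
  ... | no u≢w = none (u , ≤∧≢⇒< u≤w (u≢w ∘ toℕ-injective) , Pu)

bit-found : ∀ {n} {P : Fin n → Set} (w : Fin n) → P w → Bit (SomeBelow P (suc (toℕ w))) 1
bit-found w Pw = inj₁ (refl , w , ≤-refl , Pw)

bit-none : ∀ {n} {P : Fin n → Set} → Bit (SomeBelow P 0) 0
bit-none = inj₂ (refl , λ ())

bit-all : ∀ {n} {P : Fin n → Set} {z} → Bit (SomeBelow P n) z → Bit (∃[ u ] P u) z
bit-all (inj₁ (z≡1 , u , _ , Pu)) = inj₁ (z≡1 , u , Pu)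
bit-all (inj₂ (z≡0 , none)) = inj₂ (z≡0 , λ (u , Pu) → none (u , toℕ<n u , Pu))

-- Array updates

setArr-other : ∀ {a b} i w s → b ≢ a → ∀ j → arr (setArr a i w s) b j ≡ arr s b j
setArr-other {a} {b} i w s b≢a j with a ≡ᵇ b in eq
... | true  = contradiction (sym (≡ᵇ⇒≡ a b (subst T (sym eq) tt))) b≢a
... | false = refl

setArr-same : ∀ a i w s → arr (setArr a i w s) a i ≡ w
setArr-same a i w s with a ≡ᵇ a in eq | i ≡ᵇ i in eq′
... | true  | true  = refl
... | false | _     = ⊥-elim (subst T eq (≡⇒≡ᵇ a a refl))
... | true  | false = ⊥-elim (subst T eq′ (≡⇒≡ᵇ i i refl))

setArr-elsewhere : ∀ {i j} a w s → j ≢ i → arr (setArr a i w s) a j ≡ arr s a j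
setArr-elsewhere {i} {j} a w s j≢i with a ≡ᵇ a
... | false = refl
... | true with i ≡ᵇ j in eq
...   | true  = contradiction (sym (≡ᵇ⇒≡ i j (subst T (sym eq) tt))) j≢i
...   | false = refl

-- Reading the input

indicator-bit : ∀ {n} (D : Subset n) v → Bit (v ∈ D) (indicator D ‼ toℕ v)
indicator-bit (true  ∷ D) zero = inj₁ (refl , here)
indicator-bit (false ∷ D) zero = inj₂ (refl , λ ())
indicator-bit (_ ∷ D) (suc v) with indicator-bit D v
... | inj₁ (eq , v∈D) = inj₁ (eq , there v∈D)
... | inj₂ (eq , v∉D) = inj₂ (eq , v∉D ∘ drop-there)

indicator-injective : ∀ {n} (D E : Subset n) →
  (∀ (v : Fin n) → indicator D ‼ toℕ v ≡ indicator E ‼ toℕ v) → D ≡ E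
indicator-injective [] [] _ = refl
indicator-injective (true ∷ D) (true ∷ E) eq =
  cong (true ∷_) (indicator-injective D E (eq ∘ suc))
indicator-injective (true ∷ D) (false ∷ E) eq with () ← eq zero
indicator-injective (false ∷ D) (true ∷ E) eq with () ← eq zero
indicator-injective (false ∷ D) (false ∷ E) eq =
  cong (false ∷_) (indicator-injective D E (eq ∘ suc))

∑< : ℕ → (ℕ → ℕ) → ℕ
∑< zero    f = 0
∑< (suc i) f = ∑< i f + f i

-- `∑<` grows at the top, as the counting loop does, whereas subsets are built from the head; this
-- mediates between the two.
∑<-head : ∀ n f → ∑< (suc n) f ≡ f 0 + ∑< n (f ∘ suc)
∑<-head zero    f = sym (+-identityʳ (f 0))
∑<-head (suc n) f = trans (cong (_+ f (suc n)) (∑<-head n f)) (+-assoc (f 0) _ _)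

∑<-indicator : ∀ {n} (D : Subset n) → ∑< n (indicator D ‼_) ≡ ∣ D ∣
∑<-indicator [] = refl
∑<-indicator {suc n} (true  ∷ D) = trans (∑<-head n _) (cong suc (∑<-indicator D))
∑<-indicator {suc n} (false ∷ D) = trans (∑<-head n _) (∑<-indicator D)

-- Segment f p xs: the list xs is stored in f from position p on.
Segment : ∀ {n} → (ℕ → ℕ) → ℕ → List (Fin n) → Set
Segment f p []       = ⊤
Segment f p (x ∷ xs) = f p ≡ toℕ x × Segment f (suc p) xs

segment-cong : ∀ {n f g} p (xs : List (Fin n)) → (∀ i → f i ≡ g i) → Segment f p xs → Segment g p xs
segment-cong p [] f≗g _ = tt
segment-cong p (x ∷ xs) f≗g (eq , seg) =
  trans (sym (f≗g p)) eq , segment-cong (suc p) xs f≗g seg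

segment-shift : ∀ {n f g} (d p : ℕ) (xs : List (Fin n)) → (∀ i → g (d + i) ≡ f i) →
  Segment f p xs → Segment g (d + p) xs
segment-shift d p [] shift _ = tt
segment-shift {g = g} d p (x ∷ xs) shift (eq , seg) =
  trans (shift p) eq ,
  subst (λ q → Segment g q xs) (+-suc d p) (segment-shift d (suc p) xs shift seg)

‼-++ : ∀ vs ws i → (vs ++ ws) ‼ (length vs + i) ≡ ws ‼ i
‼-++ [] ws i = refl
‼-++ (v ∷ vs) ws i = ‼-++ vs ws i

segment-prefix : ∀ {n} (xs ys : List (Fin n)) → Segment (map toℕ (xs ++ ys) ‼_) 0 xs
segment-prefix []       ys = tt
segment-prefix (x ∷ xs) ys = refl , segment-shift 1 0 xs (λ _ → refl) (segment-prefix xs ys)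

-- For `neighbours` this is by definition the content of array 0 of `input`.
offset : ∀ {n} {A : Set} → (Fin n → List A) → ℕ → ℕ
offset f i = length (concat (take i (tabulate f)))

offset-suc : ∀ {n} {A : Set} (f : Fin n → List A) v →
  offset f (suc (toℕ v)) ≡ offset f (toℕ v) + length (f v)
offset-suc f zero = trans (length-++ (f zero)) (+-identityʳ _)
offset-suc f (suc v) = begin
  length (f zero ++ concat (take (suc (toℕ v)) (tabulate (f ∘ suc))))  ≡⟨ length-++ (f zero) ⟩
  length (f zero) + offset (f ∘ suc) (suc (toℕ v))
    ≡⟨ cong (length (f zero) +_) (offset-suc (f ∘ suc) v) ⟩
  length (f zero) + (offset (f ∘ suc) (toℕ v) + length (f (suc v)))
    ≡⟨ +-assoc (length (f zero)) _ _ ⟨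
  length (f zero) + offset (f ∘ suc) (toℕ v) + length (f (suc v))
    ≡⟨ cong (_+ length (f (suc v))) (length-++ (f zero)) ⟨
  length (f zero ++ concat (take (toℕ v) (tabulate (f ∘ suc)))) + length (f (suc v)) ∎
  where open ≡-Reasoning

offset-all : ∀ {n} {A : Set} (f : Fin n → List A) → offset f n ≡ length (concat (tabulate f))
offset-all {zero} f = refl
offset-all {suc n} f = begin
  length (f zero ++ concat (take n (tabulate (f ∘ suc))))  ≡⟨ length-++ (f zero) ⟩
  length (f zero) + offset (f ∘ suc) n  ≡⟨ cong (length (f zero) +_) (offset-all (f ∘ suc)) ⟩
  length (f zero) + length (concat (tabulate (f ∘ suc)))  ≡⟨ length-++ (f zero) ⟨
  length (f zero ++ concat (tabulate (f ∘ suc))) ∎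
  where open ≡-Reasoning


-- The induction drops the first list and shifts positions by its length. `m` and `n` are separate
-- because it shrinks the index set but not the type of the entries.
neighbour-segment : ∀ {m n} (f : Fin m → List (Fin n)) v →
  Segment (map toℕ (concat (tabulate f)) ‼_) (offset f (toℕ v)) (f v)
neighbour-segment f zero = segment-prefix (f zero) _
neighbour-segment f (suc v) =
  subst (λ p → Segment (map toℕ (concat (tabulate f)) ‼_) p (f (suc v)))
    (sym (length-++ (f zero)))
    (segment-shift (length (f zero)) (offset (f ∘ suc) (toℕ v)) (f (suc v)) shift
      (neighbour-segment (f ∘ suc) v))
  where
  rest = concat (tabulate (f ∘ suc))
  shift : ∀ i → map toℕ (f zero ++ rest) ‼ (length (f zero) + i) ≡ map toℕ rest ‼ i
  shift i = begin
    map toℕ (f zero ++ rest) ‼ (length (f zero) + i)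
      ≡⟨ cong₂ (λ ws l → ws ‼ (l + i)) (map-++ toℕ (f zero) rest) (sym (length-map toℕ (f zero))) ⟩
    (map toℕ (f zero) ++ map toℕ rest) ‼ (length (map toℕ (f zero)) + i)
      ≡⟨ ‼-++ (map toℕ (f zero)) (map toℕ rest) i ⟩
    map toℕ rest ‼ i ∎
    where open ≡-Reasoning

-- The decision program

-- Register 2 is the current vertex, 3 and 4 the number of its dominators and the
-- last one found, 5 and 6 the current and final positions in its adjacency list.
-- Register 10 answers whether the set in array a is movable and 11 saves that
-- answer for the first set, 12 tells whether the sets differ, 14 counts members,
-- and 7, 8, 9 are scratch.
scan : Arr → Program
scan a = while< 5 6
  ( load 7 1 5 ⨾ load 8 a 7 ⨾ succ 5 5 ⨾ const 9 0
  ⨾ if< 9 8 (succ 3 3 ⨾ copy 4 7) skip )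

mark : Arr → Arr → Program
mark a m = const 2 0 ⨾ while< 2 0
  ( load 3 a 2 ⨾ copy 4 2 ⨾ load 5 0 2 ⨾ succ 2 2 ⨾ load 6 0 2 ⨾ scan a ⨾ const 9 2
  -- A dominating set makes every count at least 1, so a count below 2 means that register 4 holds
  -- the only dominator.
  ⨾ if< 3 9 (const 9 1 ⨾ store m 4 9) skip )

survey : Arr → Arr → Program
survey a m = const 2 0 ⨾ const 14 0 ⨾ const 10 0 ⨾ while< 2 0
  ( load 7 a 2 ⨾ load 8 m 2 ⨾ succ 2 2 ⨾ const 9 0
  ⨾ if< 9 7 (succ 14 14 ⨾ if< 8 7 (const 10 1) skip) skip )
  ⨾ if< 14 1 (const 10 1) skip

compare : Program
compare = const 2 0 ⨾ const 12 0 ⨾ while< 2 0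
  ( load 7 2 2 ⨾ load 8 3 2 ⨾ succ 2 2
  ⨾ if< 7 8 (const 12 1) (if< 8 7 (const 12 1) skip) )

answer : Program
answer = const 9 0 ⨾ const 0 1 ⨾ if< 9 12 (if< 9 11 (copy 0 10) (const 0 0)) skip

decide : Program
decide = (mark 2 4 ⨾ survey 2 4) ⨾ copy 11 10 ⨾ (mark 3 5 ⨾ survey 3 5) ⨾ compare ⨾ answer

-- Frame conditions and the input invariant

record Same (s s′ : State) : Set where
  constructor mkSame
  field
    reg0  : reg s′ 0 ≡ reg s 0
    reg1  : reg s′ 1 ≡ reg s 1
    reg2  : reg s′ 2 ≡ reg s 2
    reg11 : reg s′ 11 ≡ reg s 11
    arrays : arr s′ ≡ arr s

-- `m` is the mark array that a check may overwrite. Register 11 is protected because it holds the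
-- first answer during the second check.
record Frame (m : Arr) (s s′ : State) : Set where
  constructor mkFrame
  field
    reg0   : reg s′ 0 ≡ reg s 0
    reg1   : reg s′ 1 ≡ reg s 1
    reg11  : reg s′ 11 ≡ reg s 11
    arrays : ∀ b → b ≢ m → ∀ j → arr s′ b j ≡ arr s b j

frame-trans : ∀ {m s s′ s″} → Frame m s s′ → Frame m s′ s″ → Frame m s s″
frame-trans F F′ = mkFrame
  (trans F′.reg0 F.reg0) (trans F′.reg1 F.reg1) (trans F′.reg11 F.reg11)
  (λ b b≢m j → trans (F′.arrays b b≢m j) (F.arrays b b≢m j))
  where
  module F = Frame F
  module F′ = Frame F′

module _ {n} {G : Graph n} (L : AdjacencyLists G) where
  open AdjacencyLists L

  record Ready (D : Subset n) (a : Arr) (s : State) : Set where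
    constructor mkReady
    field
      order     : reg s 0 ≡ n
      offsets   : ∀ i → arr s 0 i ≡ offset neighbours i
      adjacency : ∀ i → arr s 1 i ≡ map toℕ (concat (tabulate neighbours)) ‼ i
      members   : ∀ i → arr s a i ≡ indicator D ‼ i

  ready-frame : ∀ {D a m s s′} → 0 ≢ m → 1 ≢ m → a ≢ m → Frame m s s′ →
    Ready D a s → Ready D a s′
  ready-frame {a = a} 0≢m 1≢m a≢m F R = mkReady
    (trans F.reg0 R.order)
    (λ i → trans (F.arrays 0 0≢m i) (R.offsets i))
    (λ i → trans (F.arrays 1 1≢m i) (R.adjacency i))
    (λ i → trans (F.arrays a a≢m i) (R.members i))
    where
    module F = Frame F
    module R = Ready R

  -- Correctness and cost of checking one set

  module _ (D : Subset n) where

    -- `w` is the last member found. It is constrained only when it is the sole one, so overwriting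
    -- it at each further member is harmless.
    record Tally (xs : List (Fin n)) (c w : ℕ) : Set where
      constructor mkTally
      field
        count   : c ≡ length (filter (_∈? D) xs)
        witness : ∀ {v} → filter (_∈? D) xs ≡ v ∷ [] → w ≡ toℕ v

    tally-member : ∀ {xs x c w} → x ∈ D → Tally xs c w → Tally (xs ++ x ∷ []) (suc c) (toℕ x)
    tally-member {xs} {x} x∈D (mkTally refl _) = mkTally count witness
      where
      eq : filter (_∈? D) (xs ++ x ∷ []) ≡ filter (_∈? D) xs ++ x ∷ []
      eq = trans (filter-++ (_∈? D) xs (x ∷ []))
        (cong (filter (_∈? D) xs ++_) (filter-accept (_∈? D) x∈D))

      count : suc (length (filter (_∈? D) xs)) ≡ length (filter (_∈? D) (xs ++ x ∷ []))
      count = sym (trans (cong length eq) (trans (length-++ (filter (_∈? D) xs)) (+-comm _ 1)))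

      last : ∀ ys {v} → ys ++ x ∷ [] ≡ v ∷ [] → x ≡ v
      last [] refl = refl
      last (_ ∷ []) ()
      last (_ ∷ _ ∷ _) ()

      witness : ∀ {v} → filter (_∈? D) (xs ++ x ∷ []) ≡ v ∷ [] → toℕ x ≡ toℕ v
      witness eq′ = cong toℕ (last (filter (_∈? D) xs) (trans (sym eq) eq′))

    tally-nonmember : ∀ {xs x c w} → ¬ x ∈ D → Tally xs c w → Tally (xs ++ x ∷ []) c w
    tally-nonmember {xs} {x} {c} {w} x∉D (mkTally count witness) =
      mkTally (trans count (cong length (sym eq))) (λ eq′ → witness (trans (sym eq) eq′))
      where
      eq : filter (_∈? D) (xs ++ x ∷ []) ≡ filter (_∈? D) xs
      eq = trans (filter-++ (_∈? D) xs (x ∷ []))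
        (trans (cong (filter (_∈? D) xs ++_) (filter-reject (_∈? D) x∉D)) (++-identityʳ _))

    tally-singleton : ∀ {z} u → Bit (u ∈ D) z → Tally (u ∷ []) z (toℕ u)
    tally-singleton u (inj₁ (refl , u∈D)) = tally-member u∈D (mkTally {[]} {w = 0} refl λ ())
    tally-singleton u (inj₂ (refl , u∉D)) = tally-nonmember u∉D (mkTally {[]} refl λ ())

    module _ {a m : Arr} (0≢m : 0 ≢ m) (1≢m : 1 ≢ m) (a≢m : a ≢ m) where

      member-bit : ∀ {s} → Ready D a s → ∀ v → Bit (v ∈ D) (arr s a (toℕ v))
      member-bit R v = subst (Bit (v ∈ D)) (sym (Ready.members R (toℕ v))) (indicator-bit D v)

      record Scan (s₀ : State) (done todo : List (Fin n)) (s : State) : Set where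
        constructor mkScan
        field
          same    : Same s₀ s
          segment : Segment (arr s 1) (reg s 5) todo
          end     : reg s 6 ≡ reg s 5 + length todo
          tally   : Tally done (reg s 3) (reg s 4)

      -- Each entry costs at most 8 steps: the loop test, four assignments, the branch test and two
      -- assignments. The remaining 1 is the final test.
      run-scan : ∀ {s₀} → (∀ v → Bit (v ∈ D) (arr s₀ a (toℕ v))) → ∀ {done} todo {s} →
        Scan s₀ done todo s → Within (scan a) s (1 + 8 * length todo) (Scan s₀ (done ++ todo) [])
      run-scan bits {done} [] {s} inv rewrite ++-identityʳ done =
        within (while-end λ lt → <-irrefl (sym (trans (Scan.end inv) (+-identityʳ _))) lt)
          ≤-refl inv
      run-scan {s₀} bits {done} (x ∷ todo) {s} (mkScan same (read-x , segment) end tally) =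
        weaken (≤-reflexive (cong suc (sym (*-suc 8 (length todo)))))
          (within-while {Q = Scan s₀ (done ++ x ∷ []) todo}
            (subst (reg s 5 <_) (sym end) (m<m+n _ (s≤s z≤n)))
            (load ▸ load ▸ succ ▸ const ▸ within-if
              (λ pos → within (succ ⨾ copy) ≤-refl
                (mkScan (mkSame reg0 reg1 reg2 reg11 arrays) segment end′
                  (subst (Tally _ _) (sym read-x) (tally-member (positive⇒ bit pos) tally))))
              (λ ¬pos → within skip z≤n
                (mkScan (mkSame reg0 reg1 reg2 reg11 arrays) segment end′
                  (tally-nonmember (nonpositive⇒ bit ¬pos) tally))))
            λ {s′} inv → subst (λ ys → Within (scan a) s′ (1 + 8 * length todo) (Scan s₀ ys []))
                      (++-assoc done (x ∷ []) todo) (run-scan bits todo inv))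
        where
        open Same same
        end′ : reg s 6 ≡ suc (reg s 5) + length todo
        end′ = trans end (+-suc _ _)

        bit : Bit (x ∈ D) (arr s a (arr s 1 (reg s 5)))
        bit = subst₂ (λ A i → Bit (x ∈ D) (A a i)) (sym arrays) (sym read-x) (bits x)

      record Marking (s₀ : State) (i : ℕ) (s : State) : Set where
        constructor mkMarking
        field
          index : reg s 2 ≡ i
          frame : Frame m s₀ s
          marks : ∀ v → Bit (SomeBelow (λ u → dominators L D u ≡ v ∷ []) i) (arr s m (toℕ v))

      run-mark : Dominating G D → ∀ {s₀} → Ready D a s₀ → (∀ (v : Fin n) → arr s₀ m (toℕ v) ≡ 0) →
        Within (mark a m) s₀ (2 + (11 * n + 8 * offset neighbours n)) (Marking s₀ n)
      run-mark dom {s₀} R blank =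
        const ▸ for-loop (Marking s₀)
          -- The potential telescopes: 11 per vertex, including the loop test, and 8 per adjacency
          -- entry. Costs depend on a number instead of a vertex, so the degree appears below as a
          -- difference of offsets.
          (λ i → 11 * i + 8 * offset neighbours i)
          (λ i → 10 + 8 * (offset neighbours (suc i) ∸ offset neighbours i))
          (λ (mkMarking index frame _) → index , trans (Frame.reg0 frame) (Ready.order R))
          body amortised refl
          (mkMarking refl (mkFrame refl refl refl (λ _ _ _ → refl))
            (λ v → subst (Bit _) (sym (blank v)) bit-none))
        where
        degree : ∀ u → offset neighbours (suc (toℕ u)) ∸ offset neighbours (toℕ u)
          ≡ length (neighbours u)
        degree u = trans (cong (_∸ offset neighbours (toℕ u)) (offset-suc neighbours u))
          (m+n∸m≡n (offset neighbours (toℕ u)) _)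

        amortised : ∀ u →
          suc (10 + 8 * (offset neighbours (suc (toℕ u)) ∸ offset neighbours (toℕ u)))
          + (11 * toℕ u + 8 * offset neighbours (toℕ u))
          ≤ 11 * suc (toℕ u) + 8 * offset neighbours (suc (toℕ u))
        amortised u = ≤-reflexive (trans
          (cong (λ d → suc (10 + 8 * d) + (11 * toℕ u + 8 * offset neighbours (toℕ u))) (degree u))
          (trans (rearrange (length (neighbours u)) (toℕ u) (offset neighbours (toℕ u)))
            (cong (λ o → 11 * suc (toℕ u) + 8 * o) (sym (offset-suc neighbours u)))))
          where
          rearrange : ∀ d i o → suc (10 + 8 * d) + (11 * i + 8 * o) ≡ 11 * suc i + 8 * (o + d)
          rearrange = solve-∀

        body : ∀ u {s} → Marking s₀ (toℕ u) s → Within _ s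
          (10 + 8 * (offset neighbours (suc (toℕ u)) ∸ offset neighbours (toℕ u)))
          (Marking s₀ (suc (toℕ u)))
        body u {s} (mkMarking index frame marks) rewrite degree u =
          weaken (≤-reflexive (cost (length (neighbours u))))
            (load ▸ copy ▸ load ▸ succ ▸ load ▸ run-scan {scan-start} bits (neighbours u)
              (mkScan {done = u ∷ []} (mkSame refl refl refl refl refl) segment end tally)
            >>= λ { {s₂} (mkScan same _ _ (mkTally count witness)) →
              const ▸ within-if
                (λ c<2 → within (const ⨾ store) ≤-refl
                  (mkMarking (trans (Same.reg2 same) (cong suc index))
                    (frame-trans frame (mkFrame (Same.reg0 same) (Same.reg1 same) (Same.reg11 same)
                      (λ b b≢m j → trans (setArr-other {m} (reg s₂ 4) 1 s₂ b≢m j)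
                        (unscanned same b j))))
                    (mark-single (subst (_< 2) count c<2) witness
                      (setArr-same m (reg s₂ 4) 1 s₂)
                      (λ v≢ → trans (setArr-elsewhere m 1 s₂ v≢) (unscanned same m _)))))
                (λ c≮2 → within skip z≤n
                  (mkMarking (trans (Same.reg2 same) (cong suc index))
                    (frame-trans frame (mkFrame (Same.reg0 same) (Same.reg1 same) (Same.reg11 same)
                      (λ b _ j → unscanned same b j)))
                    λ v → subst (Bit _) (sym (unscanned same m _))
                      (bit-extend u (λ eq → c≮2
                        (subst (_< 2) (sym (trans count (cong length eq))) ≤-refl))
                        (marks v)))) })
          where
          scan-start = setReg 2 (suc (reg s 2)) s

          unscanned : ∀ {s₂} → Same scan-start s₂ → ∀ b j → arr s₂ b j ≡ arr s b j
          unscanned same b j = cong (λ A → A b j) (Same.arrays same)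

          -- Domination excludes the empty list, so there is exactly one dominator and `w` is it.
          -- Its cell becomes 1 and every other cell keeps its bit, as `u` is no private neighbour
          -- of any other vertex.
          mark-single : ∀ {w} {A : ℕ → ℕ} → length (dominators L D u) < 2 →
            (∀ {v} → dominators L D u ≡ v ∷ [] → w ≡ toℕ v) →
            A w ≡ 1 → (∀ {j} → j ≢ w → A j ≡ arr s m j) →
            ∀ v → Bit (SomeBelow (λ u → dominators L D u ≡ v ∷ []) (suc (toℕ u))) (A (toℕ v))
          mark-single {w} {A} short witness marked unmarked v with dominators L D u in eq
          ... | [] with x , x∈ ← dominators-nonempty L dom u with () ← subst (x ∈ˡ_) eq x∈
          ... | x ∷ y ∷ _ = contradiction short λ { (s≤s (s≤s ())) }
          ... | x ∷ [] with v ≟ x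
          ...   | yes refl = subst (Bit _) (sym (trans (cong A (sym (witness refl))) marked))
            (bit-found u eq)
          ...   | no v≢x   =
            subst (Bit _) (sym (unmarked (v≢x ∘ toℕ-injective ∘ (λ p → trans p (witness refl)))))
              (bit-extend u (λ eq′ → v≢x (other (trans (sym eq) eq′))) (marks v))
            where
            other : x ∷ [] ≡ v ∷ [] → v ≡ x
            other refl = refl

          cost : ∀ d → 5 + ((1 + 8 * d) + (1 + 3)) ≡ 10 + 8 * d
          cost = solve-∀

          R′ : Ready D a s
          R′ = ready-frame 0≢m 1≢m a≢m frame R

          bits : ∀ v → Bit (v ∈ D) (arr s a (toℕ v))
          bits = member-bit R′

          segment : Segment (arr s 1) (arr s 0 (reg s 2)) (neighbours u)
          segment rewrite index | Ready.offsets R′ (toℕ u) =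
            segment-cong _ (neighbours u) (sym ∘ Ready.adjacency R′) (neighbour-segment neighbours u)

          end : arr s 0 (suc (reg s 2)) ≡ arr s 0 (reg s 2) + length (neighbours u)
          end rewrite index | Ready.offsets R′ (toℕ u) | Ready.offsets R′ (suc (toℕ u)) =
            offset-suc neighbours u

          tally : Tally (u ∷ []) (arr s a (reg s 2)) (reg s 2)
          tally rewrite index = tally-singleton u (bits u)

      record Survey (s₀ : State) (i : ℕ) (s : State) : Set where
        constructor mkSurvey
        field
          index     : reg s 2 ≡ i
          frame     : Frame m s₀ s
          marks     : ∀ v → Bit (Critical L D v) (arr s m (toℕ v))
          size      : reg s 14 ≡ ∑< i (indicator D ‼_)
          removable : Bit (SomeBelow (Removable L D) i) (reg s 10)

      Surveyed : ℕ → State → State → Set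
      Surveyed k s₀ s = Bit (Movable L k D) (reg s 10) × Frame m s₀ s

      run-survey : ∀ {k s₀ s} → Ready D a s₀ → reg s₀ 1 ≡ k → Marking s₀ n s →
        Within (survey a m) s (3 + (suc (9 * n) + 2)) (Surveyed k s₀)
      run-survey {k} {s₀} R k≡ (mkMarking _ frame marks) =
        const ▸ const ▸ const ▸ for-loop (Survey s₀) (9 *_) (λ _ → 8)
          (λ (mkSurvey index frame _ _ _) → index , trans (Frame.reg0 frame) (Ready.order R))
          body (λ v → ≤-reflexive (sym (*-suc 9 (toℕ v)))) refl
          (mkSurvey refl (frame-trans frame (mkFrame refl refl refl (λ _ _ _ → refl)))
            (bit-all ∘ marks) refl bit-none)
        >>= λ (mkSurvey _ frame _ size removable) → within-if
          (λ lt → within const ≤-refl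
            ( inj₁ (refl , inj₁ (subst₂ _<_ (trans size (∑<-indicator D))
                (trans (Frame.reg1 frame) k≡) lt))
            , frame-trans frame (mkFrame refl refl refl (λ _ _ _ → refl))))
          (λ ≮ → within skip z≤n
            ( without-slack (≮ ∘ subst₂ _<_ (sym (trans size (∑<-indicator D)))
                  (sym (trans (Frame.reg1 frame) k≡)))
                (bit-all removable)
            , frame))
        where
        without-slack : ∀ {z} → ¬ (∣ D ∣ < k) → Bit (∃[ v ] Removable L D v) z →
          Bit (Movable L k D) z
        without-slack _   (inj₁ (eq , rem)) = inj₁ (eq , inj₂ rem)
        without-slack D≮k (inj₂ (eq , ¬rem)) =
          inj₂ (eq , λ { (inj₁ D<k) → D≮k D<k ; (inj₂ rem) → ¬rem rem })

        body : ∀ v {s} → Survey s₀ (toℕ v) s → Within _ s 8 (Survey s₀ (suc (toℕ v)))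
        body v {s} (mkSurvey index frame@(mkFrame r0 r1 r11 arrays) marks size removable) =
          load ▸ load ▸ succ ▸ const ▸ within-if
            (λ pos → succ ▸ within-if
              (λ unmarked → within const ≤-refl
                (mkSurvey (cong suc index) (mkFrame r0 r1 r11 arrays) marks (size-member pos)
                  (bit-found v (<⇒ member critical unmarked))))
              (λ marked → within skip z≤n
                (mkSurvey (cong suc index) (mkFrame r0 r1 r11 arrays) marks (size-member pos)
                  (bit-extend v (≮⇒ member critical marked) removable))))
            (λ ¬pos → within skip z≤n
              (mkSurvey (cong suc index) (mkFrame r0 r1 r11 arrays) marks
                -- A nonmember adds 0 to the sum, which is why register 14 may stay unchanged.
                (trans size (trans (sym (+-identityʳ _))
                  (cong (∑< (toℕ v) (indicator D ‼_) +_)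
                    (sym (trans (sym read) (n≤0⇒n≡0 (≮⇒≥ ¬pos)))))))
                (bit-extend v (nonpositive⇒ member ¬pos ∘ proj₁) removable)))
          where
          member : Bit (v ∈ D) (arr s a (reg s 2))
          member = subst (λ i → Bit (v ∈ D) (arr s a i)) (sym index)
            (member-bit (ready-frame 0≢m 1≢m a≢m frame R) v)

          read : arr s a (reg s 2) ≡ indicator D ‼ toℕ v
          read = trans (cong (arr s a) index)
            (Ready.members (ready-frame 0≢m 1≢m a≢m frame R) (toℕ v))

          size-member : 0 < arr s a (reg s 2) → suc (reg s 14) ≡ ∑< (suc (toℕ v)) (indicator D ‼_)
          size-member pos = trans (+-comm 1 _)
            (cong₂ _+_ size (trans (sym (positive⇒≡1 member pos)) read))

          critical : Bit (Critical L D v) (arr s m (reg s 2))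
          critical = subst (λ i → Bit _ (arr s m i)) (sym index) (marks v)

      run-check : ∀ {k s₀} → Dominating G D → Ready D a s₀ → reg s₀ 1 ≡ k →
        (∀ (v : Fin n) → arr s₀ m (toℕ v) ≡ 0) →
        Within (mark a m ⨾ survey a m) s₀ (8 + (20 * n + 8 * offset neighbours n)) (Surveyed k s₀)
      run-check dom R k≡ blank = weaken (≤-reflexive (cost n (offset neighbours n)))
        (run-mark dom R blank >>= run-survey R k≡)
        where
        cost : ∀ n o → 2 + (11 * n + 8 * o) + (3 + (suc (9 * n) + 2)) ≡ 8 + (20 * n + 8 * o)
        cost = solve-∀

-- Comparing the two sets and combining the answers

run-answer : ∀ {A B C s} → Bit A (reg s 11) → Bit B (reg s 10) → Bit C (reg s 12) →
  Within answer s 5 (λ s′ → Bit (¬ C ⊎ A × B) (reg s′ 0))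
run-answer a b c = const ▸ const ▸ within-if
  (λ posC → within-if
    (λ posA → within copy ≤-refl (both (positive⇒ a posA) (positive⇒ c posC) b))
    (λ ¬posA → within const ≤-refl
      (inj₂ (refl , λ
        { (inj₁ ¬C) → ¬C (positive⇒ c posC)
        ; (inj₂ (A , _)) → nonpositive⇒ a ¬posA A }))))
  (λ ¬posC → within skip z≤n (inj₁ (refl , inj₁ (nonpositive⇒ c ¬posC))))
  where
  both : ∀ {A B C : Set} {z} → A → C → Bit B z → Bit (¬ C ⊎ A × B) z
  both A _ (inj₁ (eq , B)) = inj₁ (eq , inj₂ (A , B))
  both _ C (inj₂ (eq , ¬B)) = inj₂ (eq , λ { (inj₁ ¬C) → ¬C C ; (inj₂ (_ , B)) → ¬B B })

module _ {n} (D E : Subset n) where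

  -- Stated for the stored numbers, whose equality is decidable; this lets `verdict` recover Ds = Dt
  -- from the absence of a differing position.
  Differ : Fin n → Set
  Differ v = indicator D ‼ toℕ v ≢ indicator E ‼ toℕ v

  record Compare (s₀ : State) (i : ℕ) (s : State) : Set where
    constructor mkCompare
    field
      index  : reg s 2 ≡ i
      reg0   : reg s 0 ≡ reg s₀ 0
      reg10  : reg s 10 ≡ reg s₀ 10
      reg11  : reg s 11 ≡ reg s₀ 11
      arrays : arr s ≡ arr s₀
      differ : Bit (SomeBelow Differ i) (reg s 12)

  run-compare : ∀ {s₀} → reg s₀ 0 ≡ n →
    (∀ i → arr s₀ 2 i ≡ indicator D ‼ i) → (∀ i → arr s₀ 3 i ≡ indicator E ‼ i) →
    Within compare s₀ (3 + 8 * n) (Compare s₀ n)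
  run-compare {s₀} order readD readE =
    const ▸ const ▸ for-loop (Compare s₀) (8 *_) (λ _ → 7)
      (λ inv → Compare.index inv , trans (Compare.reg0 inv) order)
      body (λ v → ≤-reflexive (sym (*-suc 8 (toℕ v)))) refl
      (mkCompare refl refl refl refl refl bit-none)
    where
    body : ∀ v {s} → Compare s₀ (toℕ v) s → Within _ s 7 (Compare s₀ (suc (toℕ v)))
    body v {s} (mkCompare index r0 r10 r11 arrays differ) =
      -- The body needs at most 6 steps; charging 7 makes an iteration cost 8 together with the loop
      -- test.
      weaken (≤ᵇ⇒≤ 6 7 tt) (load ▸ load ▸ succ ▸ within-if
        (λ lt → within const (s≤s z≤n)
          (mkCompare (cong suc index) r0 r10 r11 arrays (bit-found v λ eq → <-irrefl (agree eq) lt)))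
        (λ ≮ → within-if
          (λ gt → within const ≤-refl
            (mkCompare (cong suc index) r0 r10 r11 arrays
              (bit-found v λ eq → <-irrefl (sym (agree eq)) gt)))
          (λ ≯ → within skip z≤n
            (mkCompare (cong suc index) r0 r10 r11 arrays
              (bit-extend v (λ neq → neq (trans (sym readD′)
                (trans (≤-antisym (≮⇒≥ ≯) (≮⇒≥ ≮)) readE′)))
                differ)))))
      where
      readD′ : arr s 2 (reg s 2) ≡ indicator D ‼ toℕ v
      readD′ = trans (cong₂ (λ A i → A 2 i) arrays index) (readD (toℕ v))

      readE′ : arr s 3 (reg s 2) ≡ indicator E ‼ toℕ v
      readE′ = trans (cong₂ (λ A i → A 3 i) arrays index) (readE (toℕ v))

      agree : indicator D ‼ toℕ v ≡ indicator E ‼ toℕ v → arr s 2 (reg s 2) ≡ arr s 3 (reg s 2)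
      agree eq = trans readD′ (trans eq (sym readE′))

-- The decision program within its linear bound

theorem4 : Σ[ P ∈ Program ] ∃[ c ]
    (∀ (n : ℕ) (G : Graph n) → HasCanonical G →
    (L : AdjacencyLists G) (Ds Dt : Subset n) →
    Dominating G Ds → Dominating G Dt →
    (k : ℕ) → 0 < k → ∣ Ds ∣ ⊔ ∣ Dt ∣ ≤ k →
    DecidesWithin P (input L Ds Dt k) (c * suc (n + #edges G))
    (Reconfigurable G k Ds Dt))
-- 48 is the cost per vertex: 20 for each of the two checks and 8 for the comparison. It also covers
-- the additive 25 and the cost per edge, 32, as each check pays 8 for both entries of an edge.
theorem4 = decide , 48 , correct
  where
  correct : ∀ n (G : Graph n) → HasCanonical G →
    (L : AdjacencyLists G) (Ds Dt : Subset n) →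
    Dominating G Ds → Dominating G Dt →
    (k : ℕ) → 0 < k → ∣ Ds ∣ ⊔ ∣ Dt ∣ ≤ k →
    Within decide (input L Ds Dt k) (48 * suc (n + #edges G))
      (λ s → Bit (Reconfigurable G k Ds Dt) (reg s 0))
  correct n G canonical L Ds Dt domS domT k _ sizes = weaken total
    (run-check L Ds {2} {4} (λ ()) (λ ()) (λ ()) domS
      (mkReady refl (λ _ → refl) (λ _ → refl) (λ _ → refl))
      refl (λ _ → refl) >>= λ { {s₁} (movableS , F) →
    -- The second check has its own mark array 5, still blank because the first one wrote only to
    -- array 4. No clearing pass is needed.
    copy ▸ (run-check L Dt {3} {5} (λ ()) (λ ()) (λ ()) domT (readyT F)
      (Frame.reg1 F) (λ v → Frame.arrays F 5 (λ ()) (toℕ v)) >>= λ (movableT , F′) →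
    run-compare Ds Dt
      (trans (Frame.reg0 F′) (Frame.reg0 F))
      (λ i → trans (Frame.arrays F′ 2 (λ ()) i) (Frame.arrays F 2 (λ ()) i))
      (λ i → trans (Frame.arrays F′ 3 (λ ()) i) (Frame.arrays F 3 (λ ()) i)) >>= λ C →
    map-within verdict (run-answer
      (subst (Bit (Movable L k Ds)) (sym (trans (Compare.reg11 C) (Frame.reg11 F′))) movableS)
      (subst (Bit (Movable L k Dt)) (sym (Compare.reg10 C)) movableT)
      (bit-all (Compare.differ C)))) })
    where
    open AdjacencyLists L

    feasS : Feasible G k Ds
    feasS = domS , ≤-trans (m≤m⊔n _ _) sizes

    feasT : Feasible G k Dt
    feasT = domT , ≤-trans (m≤n⊔m ∣ Ds ∣ _) sizes

    readyT : ∀ {s w} → Frame 4 (input L Ds Dt k) s → Ready L Dt 3 (setReg 11 w s)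
    readyT F with ready-frame L (λ ()) (λ ()) (λ ()) F
      (mkReady {D = Dt} {a = 3} refl (λ _ → refl) (λ _ → refl) (λ _ → refl))
    ... | mkReady order offsets adjacency members = mkReady order offsets adjacency members

    verdict : ∀ {z} → Bit (¬ (∃[ v ] Differ Ds Dt v) ⊎ Movable L k Ds × Movable L k Dt) z →
      Bit (Reconfigurable G k Ds Dt) z
    verdict (inj₁ (eq , inj₂ (movS , movT))) =
      inj₁ (eq , movable⇒reconfigurable L canonical feasS feasT movS movT)
    verdict (inj₁ (eq , inj₁ same)) = inj₁ (eq , subst (Reconfigurable G k Ds)
      (indicator-injective Ds Dt (λ v → decidable-stable (_ ℕ.≟ _) (λ neq → same (v , neq))))
      (feasS , ε))
    verdict (inj₂ (eq , no-move)) = inj₂ (eq , λ r → frozen⇒¬¬≡ L (no-move ∘ inj₂) r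
      (λ { refl → no-move (inj₁ λ (_ , neq) → neq refl) }))

    total : 8 + (20 * n + 8 * offset neighbours n)
      + (1 + (8 + (20 * n + 8 * offset neighbours n) + (3 + 8 * n + 5)))
      ≤ 48 * suc (n + #edges G)
    total = begin
      8 + (20 * n + 8 * o) + (1 + (8 + (20 * n + 8 * o) + (3 + 8 * n + 5)))
        ≡⟨ collect n o ⟩
      25 + 48 * n + 16 * o
        ≤⟨ +-mono-≤ (+-monoˡ-≤ (48 * n) (m≤m+n 25 23)) (*-monoʳ-≤ 16 o≤) ⟩
      48 + 48 * n + 16 * (e + e)
        ≤⟨ m≤m+n _ (16 * e) ⟩
      48 + 48 * n + 16 * (e + e) + 16 * e
        ≡⟨ distribute n e ⟩
      48 * suc (n + e)
        ∎
      where
      open ≤-Reasoning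
      o = offset neighbours n
      e = #edges G

      o≤ : o ≤ e + e
      o≤ = ≤-trans (≤-reflexive (offset-all neighbours)) (total-degree-≤ L)

      collect : ∀ n o → 8 + (20 * n + 8 * o) + (1 + (8 + (20 * n + 8 * o) + (3 + 8 * n + 5)))
        ≡ 25 + 48 * n + 16 * o
      collect = solve-∀

      distribute : ∀ n e → 48 + 48 * n + 16 * (e + e) + 16 * e ≡ 48 * suc (n + e)
      distribute = solve-∀
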